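{- Let $d\ge 1$ and let $\mathbf{s}=(s_1,\ldots,s_d)$ be a sequence of positive integers such that $s_1=\cdots=s_i$ for some $1\le i\le d$, and $s_j<s_{j+1}$ for all $i\le j\le d-1$. Then $\mathbf{P}_d^{(\mathbf{s})}$ is translation equivalent to a Fano polytope if and only if $s_1=\cdots=s_i=i+1$ and $s_{j+1}\le 2s_j$ for all $i\le j\le d-1$. Moreover, in this case the unique interior lattice point of $\mathbf{P}_d^{(\mathbf{s})}$ is $(x_d,\ldots,x_1)^T=(s_d-1,\ldots,s_{i+1}-1,i,i-1,\ldots,2,1)^T$.
   Context: For a sequence of positive integers $\mathbf{s}=(s_1,\ldots,s_d)$, the $\mathbf{s}$-lecture hall polytope is $\mathbf{P}_d^{(\mathbf{s})}=\{\mathbf{x}\in\mathbb{R}^d : 0\le \frac{x_1}{s_1}\le\frac{x_2}{s_2}\le\cdots\le\frac{x_d}{s_d}\le 1\}$, a $d$-dimensional lattice polytope. Points are written as column vectors with $x_d$ as first entry and $x_1$ as last entry. A $d$-dimensional lattice polytope $\mathcal{P}\subset\mathbb{R}^d$ is Fano if $(\mathcal{P}\setminus\partial\mathcal{P})\cap\mathbb{Z}^d=\{\mathbf{0}\}$. Two lattice polytopes are translation equivalent if one is the translate of the other by a vector in $\mathbb{Z}^d$. -}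

module Defs where

open import Data.Bool using (if_then_else_)
open import Data.Fin using (Fin; toℕ)
open import Data.Integer as ℤ using (ℤ; +_; 0ℤ; 1ℤ)
open import Data.Nat as ℕ using (ℕ; suc; NonZero)
import Data.Nat.Properties as ℕ
open import Data.Product using (Σ-syntax; ∃-syntax; _×_; _,_; proj₁; proj₂)
open import Data.Rational as ℚ using (ℚ; 0ℚ; 1ℚ; ½)
import Data.Rational.Properties as ℚ
open import Data.Rational.Solver using (module +-*-Solver)
open import Data.Vec.Functional using (Vector; foldr)
open import Function.Bundles using (_⇔_)
open import Level using (0ℓ)
open import Relation.Binary.PropositionalEquality
  using (_≡_; refl; sym; trans; cong; subst)
open import Relation.Nullary using (does)
open import Relation.Unary using (Pred; _≐_)

------------------------------------------------------------------------
-- Real numbers: Cauchy sequences of rationals, each carrying a modulus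
-- of convergence, considered up to _≃_

IsCauchy : (ℕ → ℚ) → Set
IsCauchy x = ∀ ε → 0ℚ ℚ.< ε →
  ∃[ N ] (∀ m n → N ℕ.≤ m → N ℕ.≤ n → ℚ.∣ x m ℚ.- x n ∣ ℚ.≤ ε)

record ℝ : Set where
  constructor mkℝ
  field
    seq    : ℕ → ℚ
    cauchy : IsCauchy seq
open ℝ public

infix  4 _≤_ _≃_
infixl 6 _+_
infixr 7 _·_

_≤_ : ℝ → ℝ → Set
x ≤ y = ∀ ε → 0ℚ ℚ.< ε →
  ∃[ N ] (∀ n → N ℕ.≤ n → seq x n ℚ.≤ seq y n ℚ.+ ε)

_≃_ : ℝ → ℝ → Set
x ≃ y = x ≤ y × y ≤ x

-- The convergence proofs carry no information needed to compute with the
-- underlying sequences; unfolding them is prohibitively slow.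

abstract
  const-cauchy : ∀ q → IsCauchy (λ _ → q)
  const-cauchy q ε ε>0 = 0 , λ _ _ _ _ →
    subst (λ p → ℚ.∣ p ∣ ℚ.≤ ε) (sym (ℚ.+-inverseʳ q)) (ℚ.<⇒≤ ε>0)

  private
    ½-pos : ∀ {ε} → 0ℚ ℚ.< ε → 0ℚ ℚ.< ½ ℚ.* ε
    ½-pos {ε} ε>0 = subst (ℚ._< ½ ℚ.* ε) (ℚ.*-zeroʳ ½) (ℚ.*-monoʳ-<-pos ½ ε>0)

    ½-half : ∀ ε → ½ ℚ.* ε ℚ.+ ½ ℚ.* ε ≡ ε
    ½-half ε = trans (sym (ℚ.*-distribʳ-+ ε ½ ½)) (ℚ.*-identityˡ ε)

    interchange : ∀ a b c d → (a ℚ.+ b) ℚ.- (c ℚ.+ d) ≡ (a ℚ.- c) ℚ.+ (b ℚ.- d)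
    interchange = solve 4 (λ a b c d → (a :+ b) :- (c :+ d) := (a :- c) :+ (b :- d)) refl
      where open +-*-Solver

    factor : ∀ q a b → q ℚ.* a ℚ.- q ℚ.* b ≡ q ℚ.* (a ℚ.- b)
    factor = solve 3 (λ q a b → q :* a :- q :* b := q :* (a :- b)) refl
      where open +-*-Solver

  +-cauchy : ∀ x y → IsCauchy (λ n → seq x n ℚ.+ seq y n)
  +-cauchy x y ε ε>0 =
    let
      M , x-close = cauchy x (½ ℚ.* ε) (½-pos ε>0)
      N , y-close = cauchy y (½ ℚ.* ε) (½-pos ε>0)
    in M ℕ.⊔ N , λ m n M⊔N≤m M⊔N≤n → let open ℚ.≤-Reasoning in begin
      ℚ.∣ (seq x m ℚ.+ seq y m) ℚ.- (seq x n ℚ.+ seq y n) ∣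
        ≡⟨ cong ℚ.∣_∣ (interchange (seq x m) (seq y m) (seq x n) (seq y n)) ⟩
      ℚ.∣ (seq x m ℚ.- seq x n) ℚ.+ (seq y m ℚ.- seq y n) ∣
        ≤⟨ ℚ.∣p+q∣≤∣p∣+∣q∣ (seq x m ℚ.- seq x n) (seq y m ℚ.- seq y n) ⟩
      ℚ.∣ seq x m ℚ.- seq x n ∣ ℚ.+ ℚ.∣ seq y m ℚ.- seq y n ∣
        ≤⟨ ℚ.+-mono-≤
             (x-close m n (ℕ.m⊔n≤o⇒m≤o M N M⊔N≤m) (ℕ.m⊔n≤o⇒m≤o M N M⊔N≤n))
             (y-close m n (ℕ.m⊔n≤o⇒n≤o M N M⊔N≤m) (ℕ.m⊔n≤o⇒n≤o M N M⊔N≤n)) ⟩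
      ½ ℚ.* ε ℚ.+ ½ ℚ.* ε
        ≡⟨ ½-half ε ⟩
      ε ∎

  ·-cauchy : ∀ q x → IsCauchy (λ n → q ℚ.* seq x n)
  ·-cauchy q x ε ε>0 = let N , x-close = cauchy x δ δ>0 in N , λ m n N≤m N≤n → begin
    ℚ.∣ q ℚ.* seq x m ℚ.- q ℚ.* seq x n ∣
      ≡⟨ cong ℚ.∣_∣ (factor q (seq x m) (seq x n)) ⟩
    ℚ.∣ q ℚ.* (seq x m ℚ.- seq x n) ∣
      ≡⟨ ℚ.∣p*q∣≡∣p∣*∣q∣ q (seq x m ℚ.- seq x n) ⟩
    ℚ.∣ q ∣ ℚ.* ℚ.∣ seq x m ℚ.- seq x n ∣
      ≤⟨ ℚ.*-monoˡ-≤-nonNeg ℚ.∣ q ∣ (x-close m n N≤m N≤n) ⟩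
    ℚ.∣ q ∣ ℚ.* δ
      ≤⟨ ℚ.*-monoʳ-≤-nonNeg δ {{ℚ.nonNegative (ℚ.<⇒≤ δ>0)}}
           (subst (ℚ._≤ c) (ℚ.+-identityˡ ℚ.∣ q ∣)
             (ℚ.+-monoˡ-≤ ℚ.∣ q ∣ (ℚ.<⇒≤ (ℚ.positive⁻¹ 1ℚ)))) ⟩
    c ℚ.* δ
      ≡⟨ sym (ℚ.*-assoc c (ℚ.1/ c) ε) ⟩
    (c ℚ.* ℚ.1/ c) ℚ.* ε
      ≡⟨ cong (ℚ._* ε) (ℚ.*-inverseʳ c) ⟩
    1ℚ ℚ.* ε
      ≡⟨ ℚ.*-identityˡ ε ⟩
    ε ∎
    where
    open ℚ.≤-Reasoning

    c : ℚ
    c = 1ℚ ℚ.+ ℚ.∣ q ∣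

    instance
      ∣q∣≥0 : ℚ.NonNegative ℚ.∣ q ∣
      ∣q∣≥0 = ℚ.∣-∣-nonNeg q

      c>0 : ℚ.Positive c
      c>0 = ℚ.pos+nonNeg⇒pos 1ℚ ℚ.∣ q ∣

      c≢0 : ℚ.NonZero c
      c≢0 = ℚ.pos⇒nonZero c

      1/c>0 : ℚ.Positive (ℚ.1/ c)
      1/c>0 = ℚ.1/pos⇒pos c

    δ : ℚ
    δ = ℚ.1/ c ℚ.* ε
    δ>0 : 0ℚ ℚ.< δ
    δ>0 = subst (ℚ._< δ) (ℚ.*-zeroʳ (ℚ.1/ c)) (ℚ.*-monoʳ-<-pos (ℚ.1/ c) ε>0)

fromℚ : ℚ → ℝ
fromℚ q = mkℝ (λ _ → q) (const-cauchy q)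

fromℤ : ℤ → ℝ
fromℤ z = fromℚ (z ℚ./ 1)

0ℝ 1ℝ : ℝ
0ℝ = fromℚ 0ℚ
1ℝ = fromℚ 1ℚ

_+_ : ℝ → ℝ → ℝ
x + y = mkℝ (λ n → seq x n ℚ.+ seq y n) (+-cauchy x y)

_·_ : ℚ → ℝ → ℝ
q · x = mkℝ (λ n → q ℚ.* seq x n) (·-cauchy q x)

sum : ∀ {n} → Vector ℝ n → ℝ
sum = foldr _+_ 0ℝ

------------------------------------------------------------------------
-- Lattice polytopes in ℝᵈ

Subset : ℕ → Set₁
Subset d = Pred (Vector ℝ d) 0ℓ

lattice : ∀ {d} → Vector ℤ d → Vector ℝ d
lattice z k = fromℤ (z k)

-- The topological interior, with sup-norm neighbourhoods; rational radii
-- suffice.  Since x itself is ε-close to x, the interior is contained in P.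

Interior : ∀ {d} → Subset d → Subset d
Interior P x = Σ[ ε ∈ ℚ ] 0ℚ ℚ.< ε ×
  (∀ y → (∀ k → x k + fromℚ (ℚ.- ε) ≤ y k × y k ≤ x k + fromℚ ε) → P y)

-- All generators are lattice points, so scaling by rationals suffices to
-- form the convex combination  Σₐ cₐ vₐ.

LatticeHull : ∀ {d n} → (Fin n → Vector ℤ d) → Subset d
LatticeHull {n = n} v x = Σ[ c ∈ Vector ℝ n ]
  (∀ a → 0ℝ ≤ c a) ×
  sum c ≃ 1ℝ ×
  (∀ k → x k ≃ sum (λ a → (v a k ℚ./ 1) · c a))

IsLatticePolytope : ∀ {d} → Subset d → Set
IsLatticePolytope {d} P =
  ∃[ n ] Σ[ v ∈ (Fin n → Vector ℤ d) ] P ≐ LatticeHull v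

-- Full-dimensionality is not a separate field: it follows from 0 being an
-- interior point.

record IsFano {d} (P : Subset d) : Set where
  field
    isLatticePolytope     : IsLatticePolytope P
    interiorLatticePoints : ∀ z → Interior P (lattice z) ⇔ (∀ k → z k ≡ 0ℤ)

translate : ∀ {d} → Vector ℤ d → Subset d → Subset d
translate t P y = ∃[ x ] P x × (∀ k → y k ≃ x k + fromℤ (t k))

TranslationEquivalent : ∀ {d} → Subset d → Subset d → Set
TranslationEquivalent {d} P Q = Σ[ t ∈ Vector ℤ d ] Q ≐ translate t P

------------------------------------------------------------------------
-- Lecture hall polytopes

-- Position k : Fin d of a vector holds the coordinate with subscript
-- index k ∈ {1,…,d}; thus x₁ sits at position zero, irrespective of points
-- being displayed as columns with x_d on top.

index : ∀ {d} → Fin d → ℕ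
index k = suc (toℕ k)

module _ {d} (s : Vector ℕ d) (s≢0 : ∀ k → NonZero (s k)) where

  ratio : Vector ℝ d → Fin d → ℝ
  ratio x k = (ℚ._/_ 1ℤ (s k) {{s≢0 k}}) · x k

  record LectureHall (x : Vector ℝ d) : Set where
    field
      lower : ∀ k → index k ≡ 1 → 0ℝ ≤ ratio x k
      chain : ∀ j k → index k ≡ suc (index j) → ratio x j ≤ ratio x k
      upper : ∀ k → index k ≡ d → ratio x k ≤ 1ℝ

-- (s_d − 1, …, s_{i+1} − 1, i, …, 2, 1)ᵀ, listed with x_d first.

interiorPoint : ∀ {d} → ℕ → Vector ℕ d → Vector ℤ d
interiorPoint i s k =
  if does (index k ℕ.≤? i) then + index k else + s k ℤ.- 1ℤ

{-# OPTIONS --safe #-}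

-- A lattice point z is interior to P iff 0 < z₁/s₁ < … < z_d/s_d < 1, i.e. iff
-- its complement v = s − z satisfies v₁ < s₁, v_k s_j < v_j s_k for k = j + 1,
-- and 0 < v_d.  If there is such a v at all, then v_k ≥ 1 + (i ∸ k) and s₁ > i,
-- and v_k = 1 + (i ∸ k) is itself a solution.  Under the numerical condition
-- it is the only one; if s₁ > i + 1 then 1 + ((i + 1) ∸ k) is a second one,
-- and if s_m > 2 s_{m−1} for some m > i then so is the vector with v_m
-- replaced by 2.
--
-- P is the convex hull of the d + 1 points (0,…,0,s_a,…,s_d): the barycentric
-- coordinates of x are the consecutive differences of the ratios x_k/s_k.

module Submission where

open import Defs
open import Data.Nat using (ℕ; suc; NonZero) renaming (_≤_ to _≤ℕ_; _<_ to _<ℕ_; _*_ to _*ℕ_)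
open import Data.Vec.Functional using (Vector)
open import Data.Product using (∃-syntax; _×_)
open import Function.Bundles using (_⇔_)
open import Relation.Binary.PropositionalEquality using (_≡_)

open import Data.Bool using (if_then_else_)
open import Data.Fin using (Fin; zero; suc; fromℕ; inject₁; _≟_)
open import Data.Fin.Induction using (<-weakInduction; >-weakInduction)
open import Data.Fin.Properties using (toℕ-injective; toℕ-inject₁; toℕ-fromℕ)
open import Data.Integer as ℤ using (ℤ; +_; 0ℤ; 1ℤ)
import Data.Integer.Properties as ℤ
import Data.Integer.Solver
import Data.Nat.Coprimality as Coprime
open import Data.Nat as ℕ using (zero; _∸_; z≤n; s≤s; z<s)
import Data.Nat.Properties as ℕ
open import Data.Product using (Σ-syntax; _,_; proj₁; proj₂)
open import Data.Rational as ℚ using (ℚ; 0ℚ; 1ℚ; ½; mkℚ; *≤*; toℚᵘ)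
import Data.Rational.Properties as ℚ
import Data.Rational.Solver
import Data.Rational.Unnormalised as ℚᵘ
import Data.Rational.Unnormalised.Properties as ℚᵘ
open import Data.Sum using (inj₁; inj₂)
open import Function using (_∘_)
open import Function.Bundles using (mk⇔; module Equivalence)
open import Relation.Binary.PropositionalEquality
  using (_≢_; refl; sym; trans; cong; cong₂; subst; subst₂; module ≡-Reasoning)
open import Relation.Nullary using (does; yes; no; contradiction)
open import Relation.Nullary.Decidable using (dec-true; dec-false)
open import Relation.Unary using (_≐_)

open Data.Integer.Solver.+-*-Solver using ()
  renaming (solve to ℤ-solve; _:+_ to _⊕_; _:*_ to _⊗_; _:-_ to _⊖_; _:=_ to _⊜_)
open Data.Rational.Solver.+-*-Solver using (con; _:+_; _:*_; _:-_; :-_; _:=_)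
  renaming (solve to ℚ-solve)

-- Complements of interior lattice points

-- The step is phrased through `index`, matching the fields of `IsCochain` and `LectureHall`, so
-- that their inequalities can drive the induction directly.
ascend : ∀ {d} (P : Fin d → Set) →
  (∀ k → index k ≡ 1 → P k) →
  (∀ j k → index k ≡ suc (index j) → P j → P k) →
  ∀ k → P k
ascend {suc d} P base step =
  <-weakInduction P (base zero refl)
    (λ k → step (inject₁ k) (suc k) (cong (2 ℕ.+_) (sym (toℕ-inject₁ k))))

descend : ∀ {d} (P : Fin d → Set) →
  (∀ k → index k ≡ d → P k) →
  (∀ j k → index k ≡ suc (index j) → P k → P j) →
  ∀ k → P k
descend {suc d} P base step =
  >-weakInduction P (base (fromℕ d) (cong suc (toℕ-fromℕ d)))
    (λ k → step (inject₁ k) (suc k) (cong (2 ℕ.+_) (sym (toℕ-inject₁ k))))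

-- A lattice point z of ℝᵈ is encoded by its complement v = s − z.

record IsCochain {d} (s v : Vector ℕ d) : Set where
  field
    lower : ∀ k → index k ≡ 1 → v k ℕ.< s k
    chain : ∀ j k → index k ≡ suc (index j) → v k ℕ.* s j ℕ.< v j ℕ.* s k
    upper : ∀ k → index k ≡ d → 0 ℕ.< v k

-- Truncated subtraction makes this constantly 1 from subscript `e` on. It is used with `e = i` for
-- the least solution and with `e = suc i` for a second one.
staircase : ∀ {d} → ℕ → Vector ℕ d
staircase e k = suc (e ∸ index k)

∸-step : ∀ {e m n} → m ℕ.< e → n ≡ suc m → 1 ℕ.+ (e ∸ m) ≡ 2 ℕ.+ (e ∸ n)
∸-step {suc e} {m} (s≤s m≤e) refl = cong suc (ℕ.+-∸-assoc 1 m≤e)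

∸-flat : ∀ {e m} → e ℕ.≤ m → 1 ℕ.+ (e ∸ m) ≡ 1
∸-flat e≤m = cong suc (ℕ.m≤n⇒m∸n≡0 e≤m)

∸-top : ∀ {e m} → 1 ℕ.≤ e → m ≡ 1 → 1 ℕ.+ (e ∸ m) ≡ e
∸-top (s≤s _) refl = refl

-- Cochains over a sequence that is constant up to `i` and increasing from there

module _ {d} (s : Vector ℕ d) (s≢0 : ∀ k → NonZero (s k)) (i : ℕ)
  (1≤i : 1 ℕ.≤ i) (i≤d : i ℕ.≤ d)
  (s-const : ∀ j k → index j ℕ.≤ i → index k ℕ.≤ i → s j ≡ s k)
  (s-incr : ∀ j k → i ℕ.≤ index j → index k ≡ suc (index j) → s j ℕ.< s k)
  where

  Tight : Set
  Tight =
    (∀ k → index k ℕ.≤ i → s k ≡ suc i) ×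
    (∀ j k → i ℕ.≤ index j → index k ≡ suc (index j) → s k ℕ.≤ 2 ℕ.* s j)

  private
    head : ∀ (k : Fin d) → index k ≡ 1 → index k ℕ.≤ i
    head k k≡1 = subst (ℕ._≤ i) (sym k≡1) 1≤i

    s≡ : ∀ j k → index k ≡ suc (index j) → index j ℕ.< i → s j ≡ s k
    s≡ j k eq j<i = s-const j k (ℕ.<⇒≤ j<i) (subst (ℕ._≤ i) (sym eq) j<i)

  IsCochain⇒positive : ∀ {v} → IsCochain s v → ∀ k → 0 ℕ.< v k
  IsCochain⇒positive {v} C = descend _ (IsCochain.upper C) step
    where
    step : ∀ j k → index k ≡ suc (index j) → 0 ℕ.< v k → 0 ℕ.< v j
    step j k eq _ with v j | IsCochain.chain C j k eq
    -- If `v j` were 0, the chain inequality would put a natural number below 0.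
    ... | suc _ | _ = z<s

  -- Descending induction: from subscript `i` on the bound is 1; below `i` equal entries of `s`
  -- cancel, so `v` gains at least one with each step down.
  IsCochain⇒staircase≤ : ∀ {v} → IsCochain s v → ∀ k → staircase i k ℕ.≤ v k
  IsCochain⇒staircase≤ {v} C = descend _ base step
    where
    flat : ∀ k → i ℕ.≤ index k → staircase i k ℕ.≤ v k
    flat k i≤k = subst (ℕ._≤ v k) (sym (∸-flat i≤k)) (IsCochain⇒positive C k)

    base : ∀ k → index k ≡ d → staircase i k ℕ.≤ v k
    base k k≡d = flat k (subst (i ℕ.≤_) (sym k≡d) i≤d)

    step : ∀ j k → index k ≡ suc (index j) → staircase i k ℕ.≤ v k → staircase i j ℕ.≤ v j
    step j k eq IH with index j ℕ.<? i
    ... | no j≮i = flat j (ℕ.≮⇒≥ j≮i)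
    ... | yes j<i = begin
      staircase i j       ≡⟨ ∸-step j<i eq ⟩
      suc (staircase i k) ≤⟨ s≤s IH ⟩
      suc (v k)           ≤⟨ ℕ.*-cancelʳ-< (s k) (v k) (v j)
                               (subst (λ n → v k ℕ.* n ℕ.< v j ℕ.* s k) (s≡ j k eq j<i)
                                 (IsCochain.chain C j k eq)) ⟩
      v j                 ∎
      where open ℕ.≤-Reasoning

  -- The start is `v₁ < s₁ = i + 1`. Up to `i` equal entries of `s` cancel and force `v` to fall
  -- strictly, in pace with the staircase.
  Tight⇒≤staircase : Tight → ∀ {v} → IsCochain s v → ∀ k → v k ℕ.≤ staircase i k
  Tight⇒≤staircase (s≡1+i , s≤2s) {v} C = ascend _ base step
    where
    base : ∀ k → index k ≡ 1 → v k ℕ.≤ staircase i k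
    base k k≡1 = subst (v k ℕ.≤_) (sym (∸-top 1≤i k≡1))
      (ℕ.≤-pred (subst (v k ℕ.<_) (s≡1+i k (head k k≡1)) (IsCochain.lower C k k≡1)))

    step : ∀ j k → index k ≡ suc (index j) → v j ℕ.≤ staircase i j → v k ℕ.≤ staircase i k
    step j k eq IH with index j ℕ.<? i
    ... | yes j<i = ℕ.≤-pred (begin
      suc (v k)           ≤⟨ ℕ.*-cancelʳ-< (s k) (v k) (v j)
                               (subst (λ n → v k ℕ.* n ℕ.< v j ℕ.* s k) (s≡ j k eq j<i)
                                 (IsCochain.chain C j k eq)) ⟩
      v j                 ≤⟨ IH ⟩
      staircase i j       ≡⟨ ∸-step j<i eq ⟩
      suc (staircase i k) ∎)
      where open ℕ.≤-Reasoning
    -- From `i` on the bound for `v j` is 1, so `v k * s j < s k ≤ 2 * s j` leaves `v k ≤ 1`.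
    ... | no j≮i = ℕ.≤-trans (ℕ.≤-pred (ℕ.*-cancelʳ-< (s j) (v k) 2 (begin-strict
      v k ℕ.* s j <⟨ IsCochain.chain C j k eq ⟩
      v j ℕ.* s k ≤⟨ ℕ.*-monoˡ-≤ (s k) IH ⟩
      staircase i j ℕ.* s k ≡⟨ cong (ℕ._* s k) (∸-flat (ℕ.≮⇒≥ j≮i)) ⟩
      1 ℕ.* s k   ≡⟨ ℕ.*-identityˡ (s k) ⟩
      s k         ≤⟨ s≤2s j k (ℕ.≮⇒≥ j≮i) eq ⟩
      2 ℕ.* s j   ∎))) (s≤s z≤n)
      where open ℕ.≤-Reasoning

  -- Up to `i` the entries of `s` agree while the staircase strictly falls; afterwards the staircase
  -- does not rise while `s` strictly grows.
  staircase-IsCochain : ∀ {e} → i ℕ.≤ e → (∀ k → index k ≡ 1 → e ℕ.< s k) →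
    IsCochain s (staircase e)
  staircase-IsCochain {e} i≤e e<s = record
    { lower = λ k k≡1 → subst (ℕ._< s k) (sym (∸-top (ℕ.≤-trans 1≤i i≤e) k≡1)) (e<s k k≡1)
    ; chain = chain
    ; upper = λ _ _ → z<s
    }
    where
    instance
      s≢0′ : ∀ {k} → NonZero (s k)
      s≢0′ {k} = s≢0 k

    chain : ∀ j k → index k ≡ suc (index j) → staircase e k ℕ.* s j ℕ.< staircase e j ℕ.* s k
    chain j k eq with index j ℕ.<? i
    ... | yes j<i = begin-strict
      staircase e k ℕ.* s j       ≡⟨ cong (staircase e k ℕ.*_) (s≡ j k eq j<i) ⟩
      staircase e k ℕ.* s k       <⟨ ℕ.*-monoˡ-< (s k) (ℕ.n<1+n (staircase e k)) ⟩
      suc (staircase e k) ℕ.* s k ≡⟨ cong (ℕ._* s k) (∸-step (ℕ.<-≤-trans j<i i≤e) eq) ⟨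
      staircase e j ℕ.* s k       ∎
      where open ℕ.≤-Reasoning
    ... | no j≮i = ℕ.<-≤-trans
      (ℕ.*-monoʳ-< (staircase e k) (s-incr j k (ℕ.≮⇒≥ j≮i) eq))
      (ℕ.*-monoˡ-≤ (s k) (s≤s (ℕ.∸-monoʳ-≤ e
        (ℕ.≤-trans (ℕ.n≤1+n (index j)) (ℕ.≤-reflexive (sym eq))))))

  bump : Fin d → Vector ℕ d
  bump m k = if does (k ≟ m) then 2 else staircase i k

  -- Only the inequalities touching `m` change. The one from `l` to `m` is the gap `2 * s l < s m`;
  -- the one from `m` to its successor follows from the growth of `s`.
  bump-IsCochain : ∀ l m → i ℕ.≤ index l → index m ≡ suc (index l) → 2 ℕ.* s l ℕ.< s m →
    IsCochain s (staircase i) → IsCochain s (bump m)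
  bump-IsCochain l m i≤l m≡1+l 2s<s C = record { lower = lower ; chain = chain ; upper = upper }
    where
    open ℕ.≤-Reasoning
    index-injective : ∀ {j k : Fin d} → index j ≡ index k → j ≡ k
    index-injective = toℕ-injective ∘ ℕ.suc-injective

    lower : ∀ k → index k ≡ 1 → bump m k ℕ.< s k
    lower k k≡1 with k ≟ m
    ... | no _ = IsCochain.lower C k k≡1
    -- Having the predecessor `l`, `m` is not the first position.
    ... | yes refl with () ← trans (sym k≡1) m≡1+l

    chain : ∀ j k → index k ≡ suc (index j) → bump m k ℕ.* s j ℕ.< bump m j ℕ.* s k
    chain j k eq with j ≟ m | k ≟ m
    ... | no _ | no _ = IsCochain.chain C j k eq
    ... | yes refl | yes refl = contradiction (sym eq) ℕ.1+n≢n
    ... | yes refl | no _ = begin-strict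
      staircase i k ℕ.* s j ≡⟨ cong (ℕ._* s j) (∸-flat i≤k) ⟩
      1 ℕ.* s j             ≡⟨ ℕ.*-identityˡ (s j) ⟩
      s j                   <⟨ s-incr j k i≤j eq ⟩
      s k                   ≤⟨ ℕ.m≤n*m (s k) 2 ⟩
      2 ℕ.* s k             ∎
      where
      i≤j = ℕ.≤-trans (ℕ.m≤n⇒m≤1+n i≤l) (ℕ.≤-reflexive (sym m≡1+l))
      i≤k = ℕ.≤-trans (ℕ.m≤n⇒m≤1+n i≤j) (ℕ.≤-reflexive (sym eq))
    -- Predecessors are unique, so `j` is `l` and the gap applies.
    ... | no _ | yes refl with refl ← index-injective {j} {l} (ℕ.suc-injective (trans (sym eq) m≡1+l)) =
      begin-strict
      2 ℕ.* s l             <⟨ 2s<s ⟩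
      s m                   ≤⟨ ℕ.m≤n*m (s m) (staircase i l) ⟩
      staircase i l ℕ.* s m ∎

    upper : ∀ k → index k ≡ d → 0 ℕ.< bump m k
    upper k _ with k ≟ m
    ... | no _ = z<s
    ... | yes _ = z<s

  -- The existence of `v` gives `i < s₁`, which makes `staircase i` a solution. A violation of
  -- either upper bound yields a second solution.
  unique⇒Tight : ∀ {v} → IsCochain s v →
    (∀ {w} → IsCochain s w → ∀ k → w k ≡ v k) → Tight
  unique⇒Tight {v} C unique = s≡1+i , s≤2s
    where
    agree : ∀ {u w} → IsCochain s u → IsCochain s w → ∀ k → u k ≡ w k
    agree Cu Cw k = trans (unique Cu k) (sym (unique Cw k))

    i<s₁ : ∀ k → index k ≡ 1 → i ℕ.< s k
    i<s₁ k k≡1 = ℕ.≤-<-trans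
      (subst (ℕ._≤ v k) (∸-top 1≤i k≡1) (IsCochain⇒staircase≤ C k))
      (IsCochain.lower C k k≡1)

    base : IsCochain s (staircase i)
    base = staircase-IsCochain ℕ.≤-refl i<s₁

    s₁≤1+i : ∀ k → index k ≡ 1 → s k ℕ.≤ suc i
    s₁≤1+i k k≡1 = ℕ.≮⇒≥ λ 1+i<sₖ → ℕ.1+n≢n (begin
      suc i               ≡⟨ ∸-top z<s k≡1 ⟨
      staircase (suc i) k ≡⟨ agree (staircase-IsCochain (ℕ.n≤1+n i) λ j j≡1 →
                               subst (suc i ℕ.<_) (s-const k j (head k k≡1) (head j j≡1)) 1+i<sₖ)
                             base k ⟩
      staircase i k       ≡⟨ ∸-top 1≤i k≡1 ⟩
      i                   ∎)
      where open ≡-Reasoning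

    s≡1+i : ∀ k → index k ℕ.≤ i → s k ≡ suc i
    s≡1+i = ascend _ (λ k k≡1 _ → ℕ.≤-antisym (s₁≤1+i k k≡1) (i<s₁ k k≡1))
      λ j k eq IH k≤i → let j<i = subst (ℕ._≤ i) eq k≤i in
        trans (sym (s≡ j k eq j<i)) (IH (ℕ.<⇒≤ j<i))

    s≤2s : ∀ j k → i ℕ.≤ index j → index k ≡ suc (index j) → s k ℕ.≤ 2 ℕ.* s j
    s≤2s j k i≤j eq = ℕ.≮⇒≥ λ 2s<s → absurd
      (agree (bump-IsCochain j k i≤j eq 2s<s base) base k)
      where
      -- The position `k` lies beyond `i`, so the two values are 2 and 1.
      absurd : bump k k ≢ staircase i k
      absurd bad with k ≟ k
      ... | no k≢k = k≢k refl
      ... | yes _ with () ← trans bad (∸-flat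
                               (ℕ.≤-trans (ℕ.m≤n⇒m≤1+n i≤j) (ℕ.≤-reflexive (sym eq))))

-- The order on real numbers

infix 4 _≲_

-- The order on ℝ ignores the Cauchy proofs, so it is studied on bare
-- sequences; being a record, it lets Agda infer both sides.

record _≲_ (f g : ℕ → ℚ) : Set where
  constructor mk≲
  field
    bound : ∀ ε → 0ℚ ℚ.< ε → ∃[ N ] (∀ n → N ℕ.≤ n → f n ℚ.≤ g n ℚ.+ ε)
open _≲_

½*-pos : ∀ {ε} → 0ℚ ℚ.< ε → 0ℚ ℚ.< ½ ℚ.* ε
½*-pos = ℚ.*-monoʳ-<-pos ½

p<p+ε : ∀ p {ε} → 0ℚ ℚ.< ε → p ℚ.< p ℚ.+ ε
p<p+ε p {ε} ε>0 = subst (ℚ._< p ℚ.+ ε) (ℚ.+-identityʳ p) (ℚ.+-monoʳ-< p ε>0)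

≤⇒≲ : ∀ {f g : ℕ → ℚ} → (∀ n → f n ℚ.≤ g n) → f ≲ g
≤⇒≲ {g = g} f≤g .bound ε ε>0 = 0 , λ n _ → ℚ.≤-trans (f≤g n) (ℚ.<⇒≤ (p<p+ε (g n) ε>0))

≗⇒≲ : ∀ {f g : ℕ → ℚ} → (∀ n → f n ≡ g n) → f ≲ g
≗⇒≲ f≗g = ≤⇒≲ (ℚ.≤-reflexive ∘ f≗g)

≲-refl : ∀ {f : ℕ → ℚ} → f ≲ f
≲-refl = ≗⇒≲ λ _ → refl

≲-trans : ∀ {f g h : ℕ → ℚ} → f ≲ g → g ≲ h → f ≲ h
≲-trans {f} {g} {h} f≲g g≲h .bound ε ε>0 =
  let
    M , f≤g = f≲g .bound (½ ℚ.* ε) (½*-pos ε>0)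
    N , g≤h = g≲h .bound (½ ℚ.* ε) (½*-pos ε>0)
  in M ℕ.⊔ N , λ n M⊔N≤n → begin
    f n                               ≤⟨ f≤g n (ℕ.m⊔n≤o⇒m≤o M N M⊔N≤n) ⟩
    g n ℚ.+ ½ ℚ.* ε                   ≤⟨ ℚ.+-monoˡ-≤ (½ ℚ.* ε) (g≤h n (ℕ.m⊔n≤o⇒n≤o M N M⊔N≤n)) ⟩
    (h n ℚ.+ ½ ℚ.* ε) ℚ.+ ½ ℚ.* ε
      ≡⟨ ℚ-solve 2 (λ h ε → (h :+ con ½ :* ε) :+ con ½ :* ε := h :+ ε) refl (h n) ε ⟩
    h n ℚ.+ ε                         ∎
  where open ℚ.≤-Reasoning

+-mono-≲ : ∀ {f g h k : ℕ → ℚ} → f ≲ g → h ≲ k → (λ n → f n ℚ.+ h n) ≲ (λ n → g n ℚ.+ k n)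
+-mono-≲ {f} {g} {h} {k} f≲g h≲k .bound ε ε>0 =
  let
    M , f≤g = f≲g .bound (½ ℚ.* ε) (½*-pos ε>0)
    N , h≤k = h≲k .bound (½ ℚ.* ε) (½*-pos ε>0)
  in M ℕ.⊔ N , λ n M⊔N≤n → begin
    f n ℚ.+ h n                                 ≤⟨ ℚ.+-mono-≤ (f≤g n (ℕ.m⊔n≤o⇒m≤o M N M⊔N≤n))
                                                               (h≤k n (ℕ.m⊔n≤o⇒n≤o M N M⊔N≤n)) ⟩
    (g n ℚ.+ ½ ℚ.* ε) ℚ.+ (k n ℚ.+ ½ ℚ.* ε)     ≡⟨ ℚ-solve 3 (λ g k ε → (g :+ con ½ :* ε) :+ (k :+ con ½ :* ε) := (g :+ k) :+ ε)
                                                     refl (g n) (k n) ε ⟩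
    (g n ℚ.+ k n) ℚ.+ ε                         ∎
  where open ℚ.≤-Reasoning

-- The tolerance is rescaled by `1/q`, which is why `q = 0` is treated apart.
*-mono-≲ : ∀ q {f g : ℕ → ℚ} → 0ℚ ℚ.≤ q → f ≲ g → (λ n → q ℚ.* f n) ≲ (λ n → q ℚ.* g n)
*-mono-≲ q {f} {g} 0≤q f≲g with q ℚ.≟ 0ℚ
... | yes refl = ≗⇒≲ λ n → trans (ℚ.*-zeroˡ (f n)) (sym (ℚ.*-zeroˡ (g n)))
... | no q≢0 = scaled
  where
  instance
    q-nonZero : ℚ.NonZero q
    q-nonZero = ℚ.≢-nonZero q≢0

    q-nonNeg : ℚ.NonNegative q
    q-nonNeg = ℚ.nonNegative 0≤q

    q-pos : ℚ.Positive q
    q-pos = ℚ.nonNeg∧nonZero⇒pos q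

    1/q-pos : ℚ.Positive (ℚ.1/ q)
    1/q-pos = ℚ.1/pos⇒pos q

  open ℚ.≤-Reasoning

  scaled : (λ n → q ℚ.* f n) ≲ (λ n → q ℚ.* g n)
  scaled .bound ε ε>0 =
    let
      δ = ℚ.1/ q ℚ.* ε
      N , f≤g = f≲g .bound δ (subst (ℚ._< δ) (ℚ.*-zeroʳ (ℚ.1/ q)) (ℚ.*-monoʳ-<-pos (ℚ.1/ q) ε>0))
    in N , λ n N≤n → begin
      q ℚ.* f n                       ≤⟨ ℚ.*-monoˡ-≤-nonNeg q (f≤g n N≤n) ⟩
      q ℚ.* (g n ℚ.+ δ)               ≡⟨ ℚ.*-distribˡ-+ q (g n) δ ⟩
      q ℚ.* g n ℚ.+ q ℚ.* δ           ≡⟨ cong (q ℚ.* g n ℚ.+_) (trans (sym (ℚ.*-assoc q (ℚ.1/ q) ε))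
                                           (trans (cong (ℚ._* ε) (ℚ.*-inverseʳ q)) (ℚ.*-identityˡ ε))) ⟩
      q ℚ.* g n ℚ.+ ε                 ∎

-- If `q < p`, a rational `r` strictly between them gives the tolerance `r - q`, whence `p ≤ r < p`.
≲⇒≤ : ∀ {p q} → (λ _ → p) ≲ (λ _ → q) → p ℚ.≤ q
≲⇒≤ {p} {q} p≲q = ℚ.≮⇒≥ λ q<p →
  let r , q<r , r<p = ℚ.<-dense q<p
      N , p≤ = p≲q .bound (r ℚ.- q) (subst (ℚ._< r ℚ.- q) (ℚ.+-inverseʳ q) (ℚ.+-monoˡ-< (ℚ.- q) q<r))
  in ℚ.<-irrefl refl (ℚ.<-≤-trans r<p
       (subst (p ℚ.≤_) (ℚ-solve 2 (λ q r → q :+ (r :- q) := r) refl q r) (p≤ N ℕ.≤-refl)))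

+-monoˡ-≲ : ∀ q {f g : ℕ → ℚ} → f ≲ g → (λ n → f n ℚ.+ q) ≲ (λ n → g n ℚ.+ q)
+-monoˡ-≲ q f≲g = +-mono-≲ f≲g ≲-refl

-- The product of `q - p` and `f` is nonnegative; `p * f` is then added to both sides.
*-monoˡ-≲ : ∀ {p q} {f : ℕ → ℚ} → p ℚ.≤ q → (λ _ → 0ℚ) ≲ f → (λ n → p ℚ.* f n) ≲ (λ n → q ℚ.* f n)
*-monoˡ-≲ {p} {q} {f} p≤q 0≲f =
  ≲-trans (≗⇒≲ λ n → ℚ-solve 3 (λ p q f → p :* f := (q :- p) :* con 0ℚ :+ p :* f) refl p q (f n))
  (≲-trans (+-mono-≲ (*-mono-≲ (q ℚ.- p) 0≤q-p 0≲f) (≲-refl {λ n → p ℚ.* f n}))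
  (≗⇒≲ λ n → ℚ-solve 3 (λ p q f → (q :- p) :* f :+ p :* f := q :* f) refl p q (f n)))
  where
  0≤q-p : 0ℚ ℚ.≤ q ℚ.- p
  0≤q-p = subst (ℚ._≤ q ℚ.- p) (ℚ.+-inverseʳ p) (ℚ.+-monoˡ-≤ (ℚ.- p) p≤q)

sum-mono : ∀ {n} {x y : Vector ℝ n} → (∀ a → seq (x a) ≲ seq (y a)) → seq (sum x) ≲ seq (sum y)
sum-mono {zero}  x≤y = ≲-refl
sum-mono {suc n} {x} {y} x≤y = +-mono-≲ (x≤y zero) (sum-mono {n} {x ∘ suc} {y ∘ suc} (x≤y ∘ suc))

-- Both directions are assumed because `q` may be negative: then `-q` scales `g ≲ f`, and adding
-- `q * (f + g)` swaps the two sides.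
*-cong-≲ : ∀ q {f g : ℕ → ℚ} → f ≲ g → g ≲ f → (λ n → q ℚ.* f n) ≲ (λ n → q ℚ.* g n)
*-cong-≲ q {f} {g} f≲g g≲f with ℚ.≤-total 0ℚ q
... | inj₁ 0≤q = *-mono-≲ q 0≤q f≲g
... | inj₂ q≤0 =
  ≲-trans (≗⇒≲ λ n → ℚ-solve 3 (λ q f g → q :* f := :- q :* g :+ q :* (f :+ g)) refl q (f n) (g n))
  (≲-trans (+-mono-≲ (*-mono-≲ (ℚ.- q) (ℚ.neg-antimono-≤ q≤0) g≲f) (≲-refl {λ n → q ℚ.* (f n ℚ.+ g n)}))
  (≗⇒≲ λ n → ℚ-solve 3 (λ q f g → :- q :* f :+ q :* (f :+ g) := q :* g) refl q (f n) (g n)))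

infix 4 _≈_

_≈_ : (f g : ℕ → ℚ) → Set
f ≈ g = f ≲ g × g ≲ f

≃⇒≈ : ∀ {x y} → x ≃ y → seq x ≈ seq y
≃⇒≈ (x≤y , y≤x) = mk≲ x≤y , mk≲ y≤x

≈⇒≃ : ∀ {x y} → seq x ≈ seq y → x ≃ y
≈⇒≃ (x≲y , y≲x) = x≲y .bound , y≲x .bound

≗⇒≈ : ∀ {f g : ℕ → ℚ} → (∀ n → f n ≡ g n) → f ≈ g
≗⇒≈ f≗g = ≗⇒≲ f≗g , ≗⇒≲ (sym ∘ f≗g)

≈-sym : ∀ {f g : ℕ → ℚ} → f ≈ g → g ≈ f
≈-sym (f≲g , g≲f) = g≲f , f≲g

≈-trans : ∀ {f g h : ℕ → ℚ} → f ≈ g → g ≈ h → f ≈ h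
≈-trans (f≲g , g≲f) (g≲h , h≲g) = ≲-trans f≲g g≲h , ≲-trans h≲g g≲f

+-cong-≈ : ∀ {f g h k : ℕ → ℚ} → f ≈ g → h ≈ k → (λ n → f n ℚ.+ h n) ≈ (λ n → g n ℚ.+ k n)
+-cong-≈ (f≲g , g≲f) (h≲k , k≲h) = +-mono-≲ f≲g h≲k , +-mono-≲ g≲f k≲h

*-cong-≈ : ∀ q {f g : ℕ → ℚ} → f ≈ g → (λ n → q ℚ.* f n) ≈ (λ n → q ℚ.* g n)
*-cong-≈ q (f≲g , g≲f) = *-cong-≲ q f≲g g≲f , *-cong-≲ q g≲f f≲g

-- Integral chains

ι : ℤ → ℚ
ι z = z ℚ./ 1

private
  -- `z / 1` is normalised by a gcd and is stuck on a variable `z`; this form exposes numerator and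
  -- denominator.
  ι′ : ℤ → ℚ
  ι′ z = mkℚ z 0 (Coprime.sym (Coprime.1-coprimeTo _))

  ι≡ι′ : ∀ z → ι z ≡ ι′ z
  ι≡ι′ z = ℚ.↥p/↧p≡p (ι′ z)

ι-+ : ∀ x y → ι (x ℤ.+ y) ≡ ι x ℚ.+ ι y
ι-+ x y rewrite ι≡ι′ x | ι≡ι′ y =
  cong ι (sym (cong₂ ℤ._+_ (ℤ.*-identityʳ x) (ℤ.*-identityʳ y)))

ι-* : ∀ x y → ι (x ℤ.* y) ≡ ι x ℚ.* ι y
ι-* x y rewrite ι≡ι′ x | ι≡ι′ y = refl

ι-mono-≤ : ∀ {x y} → x ℤ.≤ y → ι x ℚ.≤ ι y
ι-mono-≤ {x} {y} x≤y rewrite ι≡ι′ x | ι≡ι′ y =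
  *≤* (subst₂ ℤ._≤_ (sym (ℤ.*-identityʳ x)) (sym (ℤ.*-identityʳ y)) x≤y)

ι-cancel-< : ∀ {x y} → ι x ℚ.< ι y → x ℤ.< y
ι-cancel-< {x} {y} ιx<ιy = ℤ.≰⇒> λ y≤x → ℚ.<-irrefl refl (ℚ.<-≤-trans ιx<ιy (ι-mono-≤ y≤x))

-- Computed with unnormalised fractions, where no gcd blocks reduction.
1/n*n≡1 : ∀ n .{{_ : NonZero n}} → (1ℤ ℚ./ n) ℚ.* ι (+ n) ≡ 1ℚ
1/n*n≡1 n@(suc n-1) = ℚ.toℚᵘ-injective (begin
  toℚᵘ ((1ℤ ℚ./ n) ℚ.* ι (+ n))          ≈⟨ ℚ.toℚᵘ-homo-* (1ℤ ℚ./ n) (ι (+ n)) ⟩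
  toℚᵘ (1ℤ ℚ./ n) ℚᵘ.* toℚᵘ (ι (+ n))    ≈⟨ ℚᵘ.*-cong (ℚ.toℚᵘ-fromℚᵘ (ℚᵘ.mkℚᵘ 1ℤ n-1)) (ℚ.toℚᵘ-fromℚᵘ (ℚᵘ.mkℚᵘ (+ n) 0)) ⟩
  ℚᵘ.mkℚᵘ 1ℤ n-1 ℚᵘ.* ℚᵘ.mkℚᵘ (+ n) 0    ≈⟨ ℚᵘ.*≡* (cong ℤ.+[1+_] (ℕ.*-distribʳ-+ 1 n-1 0)) ⟩
  toℚᵘ 1ℚ                                ∎)
  where open ℚᵘ.≃-Reasoning

-- The strict inequalities `0 < z₁/s₁ < … < z_d/s_d < 1` with denominators cleared.
record IsChain {d} (s : Vector ℕ d) (z : Vector ℤ d) : Set where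
  field
    lower : ∀ k → index k ≡ 1 → 0ℤ ℤ.< z k
    chain : ∀ j k → index k ≡ suc (index j) → z j ℤ.* + s k ℤ.< z k ℤ.* + s j
    upper : ∀ k → index k ≡ d → z k ℤ.< + s k

module _ {d} {s v : Vector ℕ d} {z : Vector ℤ d} (z≡s-v : ∀ k → z k ≡ + s k ℤ.- + v k) where

  private
    +-shift-< : ∀ {a b a′ b′} c → a ℤ.+ c ≡ a′ → b ℤ.+ c ≡ b′ → a ℤ.< b → a′ ℤ.< b′
    +-shift-< c refl refl = ℤ.+-monoˡ-< c

    v+z≡s : ∀ k → + v k ℤ.+ z k ≡ + s k
    v+z≡s k rewrite z≡s-v k = ℤ-solve 2 (λ v s → v ⊕ (s ⊖ v) ⊜ s) refl (+ v k) (+ s k)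

    -- Adding this amount to both sides of the chain inequality for `z` gives the one for `v`, and
    -- subtracting it leads back.
    offset : Fin d → Fin d → ℤ
    offset j k = + v k ℤ.* + s j ℤ.- z j ℤ.* + s k

    offsetˡ : ∀ j k → z j ℤ.* + s k ℤ.+ offset j k ≡ + v k ℤ.* + s j
    offsetˡ j k = ℤ-solve 2 (λ a b → a ⊕ (b ⊖ a) ⊜ b) refl (z j ℤ.* + s k) (+ v k ℤ.* + s j)

    offsetʳ : ∀ j k → z k ℤ.* + s j ℤ.+ offset j k ≡ + v j ℤ.* + s k
    offsetʳ j k = exchange {z j} {z k} {+ v j} {+ v k} (v+z≡s j) (v+z≡s k)
      where
      exchange : ∀ {x y v w s t} → v ℤ.+ x ≡ s → w ℤ.+ y ≡ t →
        y ℤ.* s ℤ.+ (w ℤ.* s ℤ.- x ℤ.* t) ≡ v ℤ.* t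
      exchange {x} {y} {v} {w} refl refl =
        ℤ-solve 4 (λ x y v w → y ⊗ (v ⊕ x) ⊕ (w ⊗ (v ⊕ x) ⊖ x ⊗ (w ⊕ y)) ⊜ v ⊗ (w ⊕ y))
          refl x y v w

  IsChain⇒IsCochain : IsChain s z → IsCochain s v
  IsChain⇒IsCochain C = record
    { lower = λ k k≡1 → ℤ.drop‿+<+ (+-shift-< (+ v k) (ℤ.+-identityˡ (+ v k))
                          (trans (ℤ.+-comm (z k) (+ v k)) (v+z≡s k)) (IsChain.lower C k k≡1))
    ; chain = λ j k eq → ℤ.drop‿+<+ (subst₂ ℤ._<_ (sym (ℤ.pos-* (v k) (s j))) (sym (ℤ.pos-* (v j) (s k)))
                          (+-shift-< (offset j k) (offsetˡ j k) (offsetʳ j k) (IsChain.chain C j k eq)))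
    ; upper = λ k k≡d → ℤ.drop‿+<+ (+-shift-< (ℤ.- z k) (ℤ.+-inverseʳ (z k))
                          (trans (cong (ℤ._- z k) (sym (v+z≡s k)))
                            (ℤ-solve 2 (λ v z → v ⊕ z ⊖ z ⊜ v) refl (+ v k) (z k)))
                          (IsChain.upper C k k≡d))
    }

  IsCochain⇒IsChain : IsCochain s v → IsChain s z
  IsCochain⇒IsChain C = record
    { lower = λ k k≡1 → +-shift-< (ℤ.- + v k) (ℤ.+-inverseʳ (+ v k)) (sym (z≡s-v k))
                          (ℤ.+<+ (IsCochain.lower C k k≡1))
    ; chain = λ j k eq → +-shift-< (ℤ.- offset j k)
                          (trans (cong (ℤ._- offset j k) (sym (offsetˡ j k))) (cancel _ (offset j k)))
                          (trans (cong (ℤ._- offset j k) (sym (offsetʳ j k))) (cancel _ (offset j k)))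
                          (subst₂ ℤ._<_ (ℤ.pos-* (v k) (s j)) (ℤ.pos-* (v j) (s k))
                            (ℤ.+<+ (IsCochain.chain C j k eq)))
    ; upper = λ k k≡d → +-shift-< (z k) (ℤ.+-identityˡ (z k)) (v+z≡s k) (ℤ.+<+ (IsCochain.upper C k k≡d))
    }
    where
    cancel : ∀ a b → a ℤ.+ b ℤ.- b ≡ a
    cancel = ℤ-solve 2 (λ a b → a ⊕ b ⊖ b ⊜ a) refl

module _ {d} (s : Vector ℕ d) (s≢0 : ∀ k → NonZero (s k)) where

  -- Descending induction: `z j * s k < z k * s j ≤ s k * s j`, and `s k` cancels.
  IsChain⇒<s : ∀ {z} → IsChain s z → ∀ k → z k ℤ.< + s k
  IsChain⇒<s {z} C = descend _ (IsChain.upper C) λ j k eq zₖ<sₖ →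
    ℤ.*-cancelʳ-<-nonNeg (+ s k) (begin-strict
      z j ℤ.* + s k   <⟨ IsChain.chain C j k eq ⟩
      z k ℤ.* + s j   ≤⟨ ℤ.*-monoʳ-≤-nonNeg (+ s j) (ℤ.<⇒≤ zₖ<sₖ) ⟩
      + s k ℤ.* + s j ≡⟨ ℤ.*-comm (+ s k) (+ s j) ⟩
      + s j ℤ.* + s k ∎)
    where open ℤ.≤-Reasoning

  -- Since `z k < s k`, the absolute value changes nothing; it only turns the difference into a
  -- natural number.
  complement : ∀ {z} → IsChain s z → ∀ k → z k ≡ + s k ℤ.- + ℤ.∣ + s k ℤ.- z k ∣
  complement {z} C k = trans
    (ℤ-solve 2 (λ s z → z ⊜ s ⊖ (s ⊖ z)) refl (+ s k) (z k))
    (cong (ℤ._-_ (+ s k)) (sym (ℤ.0≤i⇒+∣i∣≡i (ℤ.i≤j⇒0≤j-i (ℤ.<⇒≤ (IsChain⇒<s C k))))))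

-- Interiors and translates of polytopes

-- Membership in a translate is stated up to `≃`, so undoing a translation requires a set that
-- respects `≃`.
Extensional : ∀ {d} → Subset d → Set
Extensional P = ∀ {x y} → (∀ k → x k ≃ y k) → P x → P y

module _ {d} {P Q : Subset d} (P-ext : Extensional P) (t : Vector ℤ d) (Q≐P+t : Q ≐ translate t P)
  (z w : Vector ℤ d) (z≡w+t : ∀ k → z k ≡ w k ℤ.+ t k) where

  private
    ιz : ∀ k → ι (z k) ≡ ι (w k) ℚ.+ ι (t k)
    ιz k = trans (cong ι (z≡w+t k)) (ι-+ (w k) (t k))

    ιz+ : ∀ k ε → ι (w k) ℚ.+ ε ℚ.+ ι (t k) ≡ ι (z k) ℚ.+ ε
    ιz+ k ε rewrite ιz k = ℚ-solve 3 (λ w ε t → w :+ ε :+ t := w :+ t :+ ε) refl (ι (w k)) ε (ι (t k))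

    ιz- : ∀ k ε → ι (z k) ℚ.+ ε ℚ.+ ℚ.- ι (t k) ≡ ι (w k) ℚ.+ ε
    ιz- k ε rewrite ιz k = ℚ-solve 3 (λ w ε t → w :+ t :+ ε :+ :- t := w :+ ε) refl (ι (w k)) ε (ι (t k))

    p≡p+q-q : ∀ p q → p ≡ p ℚ.+ q ℚ.+ ℚ.- q
    p≡p+q-q = ℚ-solve 2 (λ p q → p := p :+ q :+ :- q) refl

    p≡p-q+q : ∀ p q → p ≡ p ℚ.+ ℚ.- q ℚ.+ q
    p≡p-q+q = ℚ-solve 2 (λ p q → p := p :+ :- q :+ q) refl

  -- The same radius serves: a point `y` near `w` is shifted by `t` into `Q`, and cancelling `t`
  -- identifies it with a point of `P` up to `≃`.
  Interior-untranslate : Interior Q (lattice z) → Interior P (lattice w)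
  Interior-untranslate (ε , ε>0 , nbhd) = ε , ε>0 , λ y near →
    let
      x , Px , y+t≃x+t = proj₁ Q≐P+t (nbhd (λ k → y k + fromℤ (t k)) λ k →
        ≲-trans (≗⇒≲ λ _ → sym (ιz+ k (ℚ.- ε)))
                (+-monoˡ-≲ (ι (t k)) (mk≲ {g = seq (y k)} (proj₁ (near k)))) .bound ,
        ≲-trans (+-monoˡ-≲ (ι (t k)) (mk≲ {f = seq (y k)} {λ _ → ι (w k) ℚ.+ ε} (proj₂ (near k))))
                (≗⇒≲ λ _ → ιz+ k ε) .bound)
    in P-ext (λ k → ≈⇒≃ {x k} {y k}
        (≈-trans (≗⇒≈ λ n → p≡p+q-q (seq (x k) n) (ι (t k)))
        (≈-trans (+-cong-≈ (≈-sym (≃⇒≈ {y k + fromℤ (t k)} {x k + fromℤ (t k)} (y+t≃x+t k))) (≗⇒≈ λ _ → refl))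
        (≗⇒≈ λ n → sym (p≡p+q-q (seq (y k) n) (ι (t k))))))) Px

  Interior-translate : Interior P (lattice w) → Interior Q (lattice z)
  Interior-translate (ε , ε>0 , nbhd) = ε , ε>0 , λ y near → proj₂ Q≐P+t
    ( (λ k → y k + fromℚ (ℚ.- ι (t k)))
    , nbhd _ (λ k →
        ≲-trans (≗⇒≲ λ _ → sym (ιz- k (ℚ.- ε)))
                (+-monoˡ-≲ (ℚ.- ι (t k)) (mk≲ {g = seq (y k)} (proj₁ (near k)))) .bound ,
        ≲-trans (+-monoˡ-≲ (ℚ.- ι (t k)) (mk≲ {f = seq (y k)} {λ _ → ι (z k) ℚ.+ ε} (proj₂ (near k))))
                (≗⇒≲ λ _ → ιz- k ε) .bound)
    , λ k → ≈⇒≃ {y k} {y k + fromℚ (ℚ.- ι (t k)) + fromℤ (t k)} (≗⇒≈ λ n → p≡p-q+q (seq (y k) n) (ι (t k))))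

-- Partial sums of barycentric coordinates

-- Consecutive differences of `p, r₁, …, rₙ, 1`, where `p` carries the previous ratio. Subtraction
-- is spelled as addition of a multiple by `-1`.
differences : ∀ {n} → ℝ → Vector ℝ n → Vector ℝ (suc n)
differences {zero}  p r _       = 1ℝ + (ℚ.- 1ℚ) · p
differences {suc n} p r zero    = r zero + (ℚ.- 1ℚ) · p
differences {suc n} p r (suc a) = differences (r zero) (r ∘ suc) a

sum-differences : ∀ {n} p (r : Vector ℝ n) m → seq (sum (differences p r)) m ≡ 1ℚ ℚ.- seq p m
sum-differences {zero} p r m =
  ℚ-solve 1 (λ p → con 1ℚ :+ con (ℚ.- 1ℚ) :* p :+ con 0ℚ := con 1ℚ :- p) refl (seq p m)
sum-differences {suc n} p r m = trans
  (cong (seq (r zero + (ℚ.- 1ℚ) · p) m ℚ.+_) (sum-differences (r zero) (r ∘ suc) m))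
  (ℚ-solve 2 (λ p r → r :+ con (ℚ.- 1ℚ) :* p :+ (con 1ℚ :- r) := con 1ℚ :- p) refl (seq p m) (seq (r zero) m))

-- The vertices of the lecture hall polytope are the points (χ a k · s k)ₖ.

χ : ∀ {d} → Fin (suc d) → Fin d → ℤ
χ zero    _       = 1ℤ
χ (suc a) zero    = 0ℤ
χ (suc a) (suc k) = χ a k

0≤χ : ∀ {d} a (k : Fin d) → 0ℤ ℤ.≤ χ a k
0≤χ zero    _       = ℤ.+≤+ z≤n
0≤χ (suc a) zero    = ℤ.+≤+ z≤n
0≤χ (suc a) (suc k) = 0≤χ a k

χ≤1 : ∀ {d} a (k : Fin d) → χ a k ℤ.≤ 1ℤ
χ≤1 zero    _       = ℤ.≤-refl
χ≤1 (suc a) zero    = ℤ.+≤+ z≤n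
χ≤1 (suc a) (suc k) = χ≤1 a k

χ-mono : ∀ {d} a (j k : Fin d) → index k ≡ suc (index j) → χ a j ℤ.≤ χ a k
χ-mono zero    j       k       _  = ℤ.≤-refl
χ-mono (suc a) zero    k       _  = 0≤χ (suc a) k
χ-mono (suc a) (suc j) (suc k) eq = χ-mono a j k (ℕ.suc-injective eq)

-- `χ a k` is 1 for `a ≤ k` and 0 otherwise, so this is `c₀ + … + c_k` with positions counted from
-- zero, written as a sum over all vertices.
partialSum : ∀ {d} → Vector ℝ (suc d) → Vector ℝ d
partialSum c k = sum (λ a → ι (χ a k) · c a)

sum-zero : ∀ {n} (c : Vector ℝ n) m → seq (sum (λ a → ι 0ℤ · c a)) m ≡ 0ℚ
sum-zero {zero}  c m = refl
sum-zero {suc n} c m = cong₂ ℚ._+_ (ℚ.*-zeroˡ (seq (c zero) m)) (sum-zero (c ∘ suc) m)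

-- The differences telescope, and `p` is what remains of the first one.
partialSum-differences : ∀ {n} p (r : Vector ℝ n) k m →
  seq (partialSum (differences p r) k) m ≡ seq (r k) m ℚ.- seq p m
partialSum-differences {suc n} p r zero m = trans
  (cong (1ℚ ℚ.* seq (differences p r zero) m ℚ.+_) (sum-zero (differences (r zero) (r ∘ suc)) m))
  (ℚ-solve 2 (λ p r → con 1ℚ :* (r :+ con (ℚ.- 1ℚ) :* p) :+ con 0ℚ := r :- p) refl (seq p m) (seq (r zero) m))
partialSum-differences {suc n} p r (suc k) m = trans
  (cong (1ℚ ℚ.* seq (differences p r zero) m ℚ.+_) (partialSum-differences (r zero) (r ∘ suc) k m))
  (ℚ-solve 3 (λ p r s → con 1ℚ :* (r :+ con (ℚ.- 1ℚ) :* p) :+ (s :- r) := s :- p) refl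
    (seq p m) (seq (r zero) m) (seq (r (suc k)) m))

0≲-difference : ∀ {p q : ℝ} → seq p ≲ seq q → seq 0ℝ ≲ seq (q + (ℚ.- 1ℚ) · p)
0≲-difference {p} {q} p≲q =
  ≲-trans (≗⇒≲ λ n → ℚ-solve 1 (λ p → con 0ℚ := p :+ con (ℚ.- 1ℚ) :* p) refl (seq p n))
          (+-mono-≲ p≲q (≲-refl {λ n → (ℚ.- 1ℚ) ℚ.* seq p n}))

-- The recursion moves the first ratio into the role of `p`. Once no ratios are left, the upper
-- bound falls on `p` itself, hence the premise for `n ≡ 0`.
differences-nonNeg : ∀ {n} p (r : Vector ℝ n) →
  (n ≡ 0 → seq p ≲ seq 1ℝ) →
  (∀ k → index k ≡ 1 → seq p ≲ seq (r k)) →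
  (∀ j k → index k ≡ suc (index j) → seq (r j) ≲ seq (r k)) →
  (∀ k → index k ≡ n → seq (r k) ≲ seq 1ℝ) →
  ∀ a → seq 0ℝ ≲ seq (differences p r a)
differences-nonNeg {zero}  p r p≲1 _ _ _ _ = 0≲-difference {p} {1ℝ} (p≲1 refl)
differences-nonNeg {suc n} p r _ lower _ _ zero = 0≲-difference {p} {r zero} (lower zero refl)
differences-nonNeg {suc n} p r _ lower chain upper (suc a) =
  differences-nonNeg (r zero) (r ∘ suc)
    (λ n≡0 → upper zero (cong suc (sym n≡0)))
    (λ k k≡1 → chain zero (suc k) (cong suc k≡1))
    (λ j k eq → chain (suc j) (suc k) (cong suc eq))
    (λ k k≡n → upper (suc k) (cong suc k≡n))
    a

-- Separates the scaling by `s k` from the translation by `t k` in a combination of translated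
-- vertices.
sum-affine : ∀ {n} (c : Vector ℝ n) (x y : Vector ℚ n) p q → (∀ a → y a ≡ p ℚ.* x a ℚ.+ q) → ∀ m →
  seq (sum (λ a → y a · c a)) m ≡ p ℚ.* seq (sum (λ a → x a · c a)) m ℚ.+ q ℚ.* seq (sum c) m
sum-affine {zero}  c x y p q y≡px+q m =
  ℚ-solve 2 (λ p q → con 0ℚ := p :* con 0ℚ :+ q :* con 0ℚ) refl p q
sum-affine {suc n} c x y p q y≡px+q m = trans
  (cong₂ (λ e f → e ℚ.* seq (c zero) m ℚ.+ f) (y≡px+q zero)
    (sum-affine (c ∘ suc) (x ∘ suc) (y ∘ suc) p q (y≡px+q ∘ suc) m))
  (ℚ-solve 6 (λ p q x c s t → (p :* x :+ q) :* c :+ (p :* s :+ q :* t) := p :* (x :* c :+ s) :+ q :* (c :+ t)) refl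
    p q (x zero) (seq (c zero) m) (seq (sum (λ a → x (suc a) · c (suc a))) m) (seq (sum (c ∘ suc)) m))

-- Lecture hall polytopes

bounded : ∀ {d} (s : Vector ℕ d) → ∃[ M ] (∀ k → s k ℕ.≤ M)
bounded {zero}  s = 0 , λ ()
bounded {suc d} s with M , s≤M ← bounded (s ∘ suc) = s zero ℕ.⊔ M , λ where
  zero    → ℕ.m≤m⊔n (s zero) M
  (suc k) → ℕ.≤-trans (s≤M k) (ℕ.m≤n⊔m (s zero) M)

module _ {d} (s : Vector ℕ d) (s≢0 : ∀ k → NonZero (s k)) where

  private
    instance
      s-nonZero : ∀ {k} → NonZero (s k)
      s-nonZero {k} = s≢0 k

    S u : Fin d → ℚ
    S k = ι (+ s k)
    u k = 1ℤ ℚ./ s k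

    instance
      S>0 : ∀ {k} → ℚ.Positive (S k)
      S>0 {k} = ℚ.normalize-pos (s k) 1

      u>0 : ∀ {k} → ℚ.Positive (u k)
      u>0 {k} = ℚ.normalize-pos 1 (s k)

    S≥0 : ∀ k → ℚ.NonNegative (S k)
    S≥0 k = ℚ.pos⇒nonNeg (S k)

    u≥0 : ∀ k → ℚ.NonNegative (u k)
    u≥0 k = ℚ.pos⇒nonNeg (u k)

    0≤u : ∀ k → 0ℚ ℚ.≤ u k
    0≤u k = ℚ.<⇒≤ (ℚ.positive⁻¹ (u k))

    u*S≡1 : ∀ k → u k ℚ.* S k ≡ 1ℚ
    u*S≡1 k = 1/n*n≡1 (s k)

  -- Interior lattice points as strict integral chains

  cross⇒ : ∀ j k {a b} → u j ℚ.* a ℚ.≤ u k ℚ.* b → a ℚ.* S k ℚ.≤ b ℚ.* S j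
  cross⇒ j k {a} {b} ua≤ub = begin
    a ℚ.* S k                           ≡⟨ ℚ.*-identityˡ _ ⟨
    1ℚ ℚ.* (a ℚ.* S k)                  ≡⟨ cong (ℚ._* (a ℚ.* S k)) (u*S≡1 j) ⟨
    u j ℚ.* S j ℚ.* (a ℚ.* S k)
      ≡⟨ ℚ-solve 4 (λ u s a t → u :* s :* (a :* t) := s :* (t :* (u :* a))) refl (u j) (S j) a (S k) ⟩
    S j ℚ.* (S k ℚ.* (u j ℚ.* a))
      ≤⟨ ℚ.*-monoˡ-≤-nonNeg (S j) {{S≥0 j}} (ℚ.*-monoˡ-≤-nonNeg (S k) {{S≥0 k}} ua≤ub) ⟩
    S j ℚ.* (S k ℚ.* (u k ℚ.* b))
      ≡⟨ ℚ-solve 4 (λ u s b t → t :* (s :* (u :* b)) := u :* s :* (b :* t)) refl (u k) (S k) b (S j) ⟩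
    u k ℚ.* S k ℚ.* (b ℚ.* S j)         ≡⟨ cong (ℚ._* (b ℚ.* S j)) (u*S≡1 k) ⟩
    1ℚ ℚ.* (b ℚ.* S j)                  ≡⟨ ℚ.*-identityˡ _ ⟩
    b ℚ.* S j                           ∎
    where open ℚ.≤-Reasoning

  cross⇐ : ∀ j k {a b} → a ℚ.* S k ℚ.≤ b ℚ.* S j → u j ℚ.* a ℚ.≤ u k ℚ.* b
  cross⇐ j k {a} {b} aS≤bS = begin
    u j ℚ.* a                           ≡⟨ ℚ.*-identityˡ _ ⟨
    1ℚ ℚ.* (u j ℚ.* a)                  ≡⟨ cong (ℚ._* (u j ℚ.* a)) (u*S≡1 k) ⟨
    u k ℚ.* S k ℚ.* (u j ℚ.* a)
      ≡⟨ ℚ-solve 4 (λ u s a t → u :* s :* (t :* a) := t :* (u :* (a :* s))) refl (u k) (S k) a (u j) ⟩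
    u j ℚ.* (u k ℚ.* (a ℚ.* S k))
      ≤⟨ ℚ.*-monoˡ-≤-nonNeg (u j) {{u≥0 j}} (ℚ.*-monoˡ-≤-nonNeg (u k) {{u≥0 k}} aS≤bS) ⟩
    u j ℚ.* (u k ℚ.* (b ℚ.* S j))
      ≡⟨ ℚ-solve 4 (λ u s b t → u :* (t :* (b :* s)) := u :* s :* (t :* b)) refl (u j) (S j) b (u k) ⟩
    u j ℚ.* S j ℚ.* (u k ℚ.* b)         ≡⟨ cong (ℚ._* (u k ℚ.* b)) (u*S≡1 j) ⟩
    1ℚ ℚ.* (u k ℚ.* b)                  ≡⟨ ℚ.*-identityˡ _ ⟩
    u k ℚ.* b                           ∎
    where open ℚ.≤-Reasoning

  -- Each weak inequality becomes strict at `z` by testing it at a nearby point that makes it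
  -- harder: all coordinates lowered by `ε`, only `z j` raised, or all raised.
  Interior⇒IsChain : ∀ {z} → Interior (LectureHall s s≢0) (lattice z) → IsChain s z
  Interior⇒IsChain {z} (ε , ε>0 , nbhd) = record
    { lower = λ k k≡1 → ι-cancel-< (begin-strict
        0ℚ                 <⟨ ε>0 ⟩
        ε                  ≡⟨ ℚ.+-identityˡ ε ⟨
        0ℚ ℚ.+ ε           ≤⟨ ℚ.+-monoˡ-≤ ε (ℚ.*-cancelˡ-≤-pos (u k)
                               (subst (ℚ._≤ u k ℚ.* (ι (z k) ℚ.+ ℚ.- ε)) (sym (ℚ.*-zeroʳ (u k)))
                                 (≲⇒≤ (mk≲ (LectureHall.lower (perturbed (λ _ → ℚ.- ε) λ _ → ℚ.≤-refl , ℚ.<⇒≤ -ε<ε) k k≡1))))) ⟩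
        ι (z k) ℚ.+ ℚ.- ε ℚ.+ ε ≡⟨ ℚ-solve 2 (λ z ε → z :+ :- ε :+ ε := z) refl (ι (z k)) ε ⟩
        ι (z k)            ∎)
    ; chain = λ j k eq → ι-cancel-< (begin-strict
        ι (z j ℤ.* + s k)             ≡⟨ ι-* (z j) (+ s k) ⟩
        ι (z j) ℚ.* S k               <⟨ ℚ.*-monoˡ-<-pos (S k) (p<p+ε (ι (z j)) ε>0) ⟩
        (ι (z j) ℚ.+ ε) ℚ.* S k       ≡⟨ cong (λ q → (ι (z j) ℚ.+ q) ℚ.* S k) (δ-on j) ⟨
        (ι (z j) ℚ.+ δ j j) ℚ.* S k
          ≤⟨ cross⇒ j k (≲⇒≤ (mk≲ (LectureHall.chain (perturbed (δ j) (δ-bound j)) j k eq))) ⟩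
        (ι (z k) ℚ.+ δ j k) ℚ.* S j
          ≡⟨ cong (λ q → (ι (z k) ℚ.+ q) ℚ.* S j) (δ-off j k λ { refl → ℕ.1+n≢n (sym eq) }) ⟩
        (ι (z k) ℚ.+ 0ℚ) ℚ.* S j      ≡⟨ cong (ℚ._* S j) (ℚ.+-identityʳ (ι (z k))) ⟩
        ι (z k) ℚ.* S j               ≡⟨ ι-* (z k) (+ s j) ⟨
        ι (z k ℤ.* + s j)             ∎)
    ; upper = λ k k≡d → ι-cancel-< (begin-strict
        ι (z k)            <⟨ p<p+ε (ι (z k)) ε>0 ⟩
        ι (z k) ℚ.+ ε      ≤⟨ ℚ.*-cancelˡ-≤-pos (u k)
                               (subst (u k ℚ.* (ι (z k) ℚ.+ ε) ℚ.≤_) (sym (u*S≡1 k))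
                                 (≲⇒≤ (mk≲ (LectureHall.upper (perturbed (λ _ → ε) λ _ → ℚ.<⇒≤ -ε<ε , ℚ.≤-refl) k k≡d)))) ⟩
        S k                ∎)
    }
    where
    open ℚ.≤-Reasoning

    -ε<ε : ℚ.- ε ℚ.< ε
    -ε<ε = ℚ.<-trans (ℚ.neg-antimono-< ε>0) ε>0

    perturbed : (σ : Vector ℚ d) → (∀ k → ℚ.- ε ℚ.≤ σ k × σ k ℚ.≤ ε) →
      LectureHall s s≢0 (λ k → fromℚ (ι (z k) ℚ.+ σ k))
    perturbed σ σ≤ε = nbhd _ λ k →
      ≤⇒≲ (λ _ → ℚ.+-monoʳ-≤ (ι (z k)) (proj₁ (σ≤ε k))) .bound ,
      ≤⇒≲ (λ _ → ℚ.+-monoʳ-≤ (ι (z k)) (proj₂ (σ≤ε k))) .bound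

    δ : Fin d → Vector ℚ d
    δ j k = if does (k ≟ j) then ε else 0ℚ

    δ-on : ∀ j → δ j j ≡ ε
    δ-on j rewrite dec-true (j ≟ j) refl = refl

    δ-off : ∀ j k → k ≢ j → δ j k ≡ 0ℚ
    δ-off j k k≢j rewrite dec-false (k ≟ j) k≢j = refl

    δ-bound : ∀ j k → ℚ.- ε ℚ.≤ δ j k × δ j k ℚ.≤ ε
    δ-bound j k with k ≟ j
    ... | yes _ = ℚ.<⇒≤ -ε<ε , ℚ.≤-refl
    ... | no _  = ℚ.<⇒≤ (ℚ.neg-antimono-< ε>0) , ℚ.<⇒≤ ε>0

  private
    radius : Σ[ ε ∈ ℚ ] 0ℚ ℚ.< ε × ε ℚ.≤ 1ℚ × (∀ j k → ε ℚ.* (S j ℚ.+ S k) ℚ.≤ 1ℚ)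
    radius = ε , ℚ.positive⁻¹ ε , ε≤1 , ε*S≤1
      where
      open ℚ.≤-Reasoning
      M = proj₁ (bounded s)
      -- Exceeds every `s j + s k` and is nonzero, so its reciprocal is a suitable radius.
      N = suc (M ℕ.+ M)
      ε = 1ℤ ℚ./ N

      instance
        ε-pos : ℚ.Positive ε
        ε-pos = ℚ.normalize-pos 1 N

        ε-nonNeg : ℚ.NonNegative ε
        ε-nonNeg = ℚ.pos⇒nonNeg ε

      ε*≤1 : ∀ {n} → n ℕ.≤ N → ε ℚ.* ι (+ n) ℚ.≤ 1ℚ
      ε*≤1 {n} n≤N = begin
        ε ℚ.* ι (+ n) ≤⟨ ℚ.*-monoˡ-≤-nonNeg ε (ι-mono-≤ (ℤ.+≤+ n≤N)) ⟩
        ε ℚ.* ι (+ N) ≡⟨ 1/n*n≡1 N ⟩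
        1ℚ            ∎

      ε≤1 : ε ℚ.≤ 1ℚ
      ε≤1 = subst (ℚ._≤ 1ℚ) (ℚ.*-identityʳ ε) (ε*≤1 (s≤s z≤n))

      ε*S≤1 : ∀ j k → ε ℚ.* (S j ℚ.+ S k) ℚ.≤ 1ℚ
      ε*S≤1 j k = subst (λ q → ε ℚ.* q ℚ.≤ 1ℚ) (ι-+ (+ s j) (+ s k))
        (ε*≤1 (ℕ.m≤n⇒m≤1+n (ℕ.+-mono-≤ (proj₂ (bounded s) j) (proj₂ (bounded s) k))))

  -- Strict inequalities between integers leave a gap of at least 1, which absorbs the error
  -- `ε * (s j + s k)` of the cleared chain inequality.
  IsChain⇒Interior : ∀ {z} → IsChain s z → Interior (LectureHall s s≢0) (lattice z)
  IsChain⇒Interior {z} C with ε , ε>0 , ε≤1 , ε*S≤1 ← radius = ε , ε>0 , λ y near → record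
    { lower = λ k k≡1 → (≲-trans (≤⇒≲ λ _ → lower k k≡1) (*-mono-≲ (u k) (0≤u k) (mk≲ (proj₁ (near k))))) .bound
    ; chain = λ j k eq → (≲-trans (*-mono-≲ (u j) (0≤u j) (mk≲ (proj₂ (near j))))
                         (≲-trans (≤⇒≲ λ _ → chain j k eq)
                         (*-mono-≲ (u k) (0≤u k) (mk≲ (proj₁ (near k)))))) .bound
    ; upper = λ k k≡d → (≲-trans (*-mono-≲ (u k) (0≤u k) (mk≲ (proj₂ (near k)))) (≤⇒≲ λ _ → upper k k≡d)) .bound
    }
    where
    open ℚ.≤-Reasoning

    1+-≤ : ∀ {x y} → x ℤ.< y → ι x ℚ.+ 1ℚ ℚ.≤ ι y
    1+-≤ {x} {y} x<y = subst (ℚ._≤ ι y) (trans (cong ι (ℤ.+-comm 1ℤ x)) (ι-+ x 1ℤ)) (ι-mono-≤ (ℤ.i<j⇒suc[i]≤j x<y))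

    lower : ∀ k → index k ≡ 1 → 0ℚ ℚ.≤ u k ℚ.* (ι (z k) ℚ.+ ℚ.- ε)
    lower k k≡1 = begin
      0ℚ                            ≡⟨ ℚ.*-zeroʳ (u k) ⟨
      u k ℚ.* 0ℚ                    ≡⟨ cong (u k ℚ.*_) (ℚ.+-inverseʳ ε) ⟨
      u k ℚ.* (ε ℚ.+ ℚ.- ε)         ≤⟨ ℚ.*-monoˡ-≤-nonNeg (u k) {{u≥0 k}}
                                         (ℚ.+-monoˡ-≤ (ℚ.- ε) (ℚ.≤-trans ε≤1 (1+-≤ (IsChain.lower C k k≡1)))) ⟩
      u k ℚ.* (ι (z k) ℚ.+ ℚ.- ε)   ∎

    chain : ∀ j k → index k ≡ suc (index j) →
      u j ℚ.* (ι (z j) ℚ.+ ε) ℚ.≤ u k ℚ.* (ι (z k) ℚ.+ ℚ.- ε)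
    -- Writing `ε * s k` as `ε * (s j + s k) - ε * s j` isolates the error to be absorbed and leaves
    -- the shift by `-ε` on the right.
    chain j k eq = cross⇐ j k (begin
      (ι (z j) ℚ.+ ε) ℚ.* S k
        ≡⟨ ℚ-solve 4 (λ z ε t s → (z :+ ε) :* t := z :* t :+ ε :* (s :+ t) :+ :- (ε :* s)) refl (ι (z j)) ε (S k) (S j) ⟩
      ι (z j) ℚ.* S k ℚ.+ ε ℚ.* (S j ℚ.+ S k) ℚ.+ ℚ.- (ε ℚ.* S j)
        ≤⟨ ℚ.+-monoˡ-≤ (ℚ.- (ε ℚ.* S j)) (ℚ.+-monoʳ-≤ (ι (z j) ℚ.* S k) (ε*S≤1 j k)) ⟩
      ι (z j) ℚ.* S k ℚ.+ 1ℚ ℚ.+ ℚ.- (ε ℚ.* S j)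
        ≤⟨ ℚ.+-monoˡ-≤ (ℚ.- (ε ℚ.* S j))
             (subst₂ (λ p q → p ℚ.+ 1ℚ ℚ.≤ q) (ι-* (z j) (+ s k)) (ι-* (z k) (+ s j)) (1+-≤ (IsChain.chain C j k eq))) ⟩
      ι (z k) ℚ.* S j ℚ.+ ℚ.- (ε ℚ.* S j)
        ≡⟨ ℚ-solve 3 (λ z ε s → z :* s :+ :- (ε :* s) := (z :+ :- ε) :* s) refl (ι (z k)) ε (S j) ⟩
      (ι (z k) ℚ.+ ℚ.- ε) ℚ.* S j
        ∎)

    upper : ∀ k → index k ≡ d → u k ℚ.* (ι (z k) ℚ.+ ε) ℚ.≤ 1ℚ
    upper k k≡d = begin
      u k ℚ.* (ι (z k) ℚ.+ ε) ≤⟨ ℚ.*-monoˡ-≤-nonNeg (u k) {{u≥0 k}}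
                                   (ℚ.≤-trans (ℚ.+-monoʳ-≤ (ι (z k)) ε≤1) (1+-≤ (IsChain.upper C k k≡d))) ⟩
      u k ℚ.* S k             ≡⟨ u*S≡1 k ⟩
      1ℚ                      ∎

  LectureHall-extensional : Extensional (LectureHall s s≢0)
  LectureHall-extensional {x} {y} x≃y P = record
    { lower = λ k k≡1 → (≲-trans (mk≲ (LectureHall.lower P k k≡1)) (proj₁ (r≈ k))) .bound
    ; chain = λ j k eq → (≲-trans (proj₂ (r≈ j)) (≲-trans (mk≲ (LectureHall.chain P j k eq)) (proj₁ (r≈ k)))) .bound
    ; upper = λ k k≡d → (≲-trans (proj₂ (r≈ k)) (mk≲ {g = seq 1ℝ} (LectureHall.upper P k k≡d))) .bound
    }
    where
    r≈ : ∀ k → seq (ratio s s≢0 x k) ≈ seq (ratio s s≢0 y k)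
    r≈ k = *-cong-≈ (u k) (≃⇒≈ {x k} {y k} (x≃y k))

  -- Translated lecture hall polytopes as convex hulls of lattice points

  module _ (t : Vector ℤ d) where

    private
      r : Vector ℝ d → Vector ℝ d
      r = ratio s s≢0

      cancelˡ : ∀ k p → u k ℚ.* (S k ℚ.* p) ≡ p
      cancelˡ k p = trans (sym (ℚ.*-assoc (u k) (S k) p)) (trans (cong (ℚ._* p) (u*S≡1 k)) (ℚ.*-identityˡ p))

      cancelʳ : ∀ k p → S k ℚ.* (u k ℚ.* p) ≡ p
      cancelʳ k p = trans (sym (ℚ.*-assoc (S k) (u k) p))
        (trans (cong (ℚ._* p) (trans (ℚ.*-comm (S k) (u k)) (u*S≡1 k))) (ℚ.*-identityˡ p))

    vertex : Fin (suc d) → Vector ℤ d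
    vertex a k = + s k ℤ.* χ a k ℤ.+ t k

    private
      combination : ∀ c k m → seq (sum (λ a → ι (vertex a k) · c a)) m ≡
        S k ℚ.* seq (partialSum c k) m ℚ.+ ι (t k) ℚ.* seq (sum c) m
      combination c k = sum-affine c (λ a → ι (χ a k)) (λ a → ι (vertex a k)) (S k) (ι (t k)) λ a →
        trans (ι-+ (+ s k ℤ.* χ a k) (t k)) (cong (ℚ._+ ι (t k)) (ι-* (+ s k) (χ a k)))

      scaled : Vector ℝ (suc d) → Vector ℝ d
      scaled c k = S k · partialSum c k

      r≗ : ∀ c k m → seq (r (scaled c) k) m ≡ seq (partialSum c k) m
      r≗ c k m = cancelˡ k (seq (partialSum c k) m)

    -- With the differences of the ratios as coefficients, coordinate `k` of the combination is
    -- `s k` times the ratio of `x` at `k`, plus `t k` because the coefficients sum to 1.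
    translate⊆hull : ∀ {y} → translate t (LectureHall s s≢0) y → LatticeHull vertex y
    translate⊆hull {y} (x , P , y≃x+t) =
      c , (λ a → c≥0 a .bound) , ≈⇒≃ {sum c} {1ℝ} (≗⇒≈ sum≗1) , λ k →
      ≈⇒≃ {y k} {sum (λ a → ι (vertex a k) · c a)}
        (≈-trans (≃⇒≈ {y k} {x k + fromℤ (t k)} (y≃x+t k)) (≗⇒≈ (x+t≗ k)))
      where
      c : Vector ℝ (suc d)
      c = differences 0ℝ (r x)

      c≥0 : ∀ a → seq 0ℝ ≲ seq (c a)
      c≥0 = differences-nonNeg 0ℝ (r x) (λ _ → ≤⇒≲ λ _ → ℚ.<⇒≤ (ℚ.positive⁻¹ 1ℚ))
        (λ k k≡1 → mk≲ (LectureHall.lower P k k≡1))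
        (λ j k eq → mk≲ (LectureHall.chain P j k eq))
        (λ k k≡d → mk≲ (LectureHall.upper P k k≡d))

      sum≗1 : ∀ m → seq (sum c) m ≡ 1ℚ
      sum≗1 m = sum-differences 0ℝ (r x) m

      x+t≗ : ∀ k m → seq (x k) m ℚ.+ ι (t k) ≡ seq (sum (λ a → ι (vertex a k) · c a)) m
      x+t≗ k m = sym (trans (combination c k m) (cong₂ ℚ._+_
        (trans (cong (S k ℚ.*_) (trans (partialSum-differences 0ℝ (r x) k m) (ℚ.+-identityʳ _)))
               (cancelʳ k (seq (x k) m)))
        (trans (cong (ι (t k) ℚ.*_) (sum≗1 m)) (ℚ.*-identityʳ (ι (t k))))))

    -- The ratios of the preimage `scaled c` are the partial sums of `c`, which rise from at least 0
    -- to at most 1.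
    hull⊆translate : ∀ {y} → LatticeHull vertex y → translate t (LectureHall s s≢0) y
    hull⊆translate {y} (c , c≥0 , sum≃1 , y≃) = scaled c , P , λ k →
      ≈⇒≃ {y k} {scaled c k + fromℤ (t k)}
        (≈-trans (≃⇒≈ {y k} {sum (λ a → ι (vertex a k) · c a)} (y≃ k))
        (≈-trans (≗⇒≈ (combination c k))
        (+-cong-≈ (≗⇒≈ {seq (scaled c k)} λ _ → refl)
          (≈-trans (*-cong-≈ (ι (t k)) (≃⇒≈ {sum c} {1ℝ} sum≃1)) (≗⇒≈ λ _ → ℚ.*-identityʳ (ι (t k)))))))
      where
      0≤partialSum : ∀ k → seq 0ℝ ≲ seq (partialSum c k)
      0≤partialSum k = ≲-trans (≗⇒≲ λ m → sym (sum-zero c m))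
        (sum-mono {x = λ a → ι 0ℤ · c a} {y = λ a → ι (χ a k) · c a}
          λ a → *-monoˡ-≲ (ι-mono-≤ (0≤χ a k)) (mk≲ (c≥0 a)))

      partialSum-mono : ∀ j k → index k ≡ suc (index j) → seq (partialSum c j) ≲ seq (partialSum c k)
      partialSum-mono j k eq =
        sum-mono {x = λ a → ι (χ a j) · c a} {y = λ a → ι (χ a k) · c a}
          λ a → *-monoˡ-≲ (ι-mono-≤ (χ-mono a j k eq)) (mk≲ (c≥0 a))

      partialSum≤1 : ∀ k → seq (partialSum c k) ≲ seq 1ℝ
      partialSum≤1 k = ≲-trans
        (sum-mono {x = λ a → ι (χ a k) · c a} {y = c} λ a →
          ≲-trans (*-monoˡ-≲ (ι-mono-≤ (χ≤1 a k)) (mk≲ (c≥0 a))) (≗⇒≲ λ m → ℚ.*-identityˡ (seq (c a) m)))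
        (mk≲ (proj₁ sum≃1))

      P : LectureHall s s≢0 (scaled c)
      P = record
        { lower = λ k _ → ≲-trans (0≤partialSum k) (≗⇒≲ λ m → sym (r≗ c k m)) .bound
        ; chain = λ j k eq → ≲-trans (≗⇒≲ (r≗ c j))
                            (≲-trans (partialSum-mono j k eq) (≗⇒≲ λ m → sym (r≗ c k m))) .bound
        ; upper = λ k _ → ≲-trans (≗⇒≲ (r≗ c k)) (partialSum≤1 k) .bound
        }

    translate-isLatticePolytope : IsLatticePolytope (translate t (LectureHall s s≢0))
    translate-isLatticePolytope = suc d , vertex , (λ {y} → translate⊆hull {y}) , (λ {y} → hull⊆translate {y})

-- The interior lattice point and the Fano condition

interiorPoint≡ : ∀ {d} (s : Vector ℕ d) i → (∀ k → index k ℕ.≤ i → s k ≡ suc i) →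
  ∀ k → interiorPoint i s k ≡ + s k ℤ.- + staircase i k
interiorPoint≡ s i s≡1+i k with index k ℕ.≤? i
-- Up to `i` the value is `(i + 1) - (1 + (i - k)) = k` for the subscript `k`; beyond `i` the
-- staircase is 1.
... | yes k≤i rewrite dec-true (index k ℕ.≤? i) k≤i = sym (begin
  + s k ℤ.- + staircase i k         ≡⟨ cong (λ n → + n ℤ.- + staircase i k) (s≡1+i k k≤i) ⟩
  + suc i ℤ.- + staircase i k       ≡⟨ ℤ.[+m]-[+n]≡m⊖n (suc i) (staircase i k) ⟩
  suc i ℤ.⊖ staircase i k           ≡⟨ ℤ.⊖-≥ (s≤s (ℕ.m∸n≤m i (index k))) ⟩
  + (i ∸ (i ∸ index k))             ≡⟨ cong +_ (ℕ.m∸[m∸n]≡n k≤i) ⟩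
  + index k                         ∎)
  where open ≡-Reasoning
... | no k≰i rewrite dec-false (index k ℕ.≤? i) k≰i =
  cong (λ n → + s k ℤ.- + n) (sym (∸-flat (ℕ.<⇒≤ (ℕ.≰⇒> k≰i))))

theorem2p5 :
  ∀ (d : ℕ) → 1 ≤ℕ d →
  ∀ (s : Vector ℕ d) (s≢0 : ∀ k → NonZero (s k)) →
  ∀ (i : ℕ) → 1 ≤ℕ i → i ≤ℕ d →
  (∀ j k → index j ≤ℕ i → index k ≤ℕ i → s j ≡ s k) →
  (∀ j k → i ≤ℕ index j → index k ≡ suc (index j) → s j <ℕ s k) →
  let
    P = LectureHall s s≢0
    Condition =
      (∀ k → index k ≤ℕ i → s k ≡ suc i) ×
      (∀ j k → i ≤ℕ index j → index k ≡ suc (index j) → s k ≤ℕ 2 *ℕ s j)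
  in
    ((∃[ Q ] (IsFano Q × TranslationEquivalent P Q)) ⇔ Condition) ×
    (Condition → ∀ z → Interior P (lattice z) ⇔ (∀ k → z k ≡ interiorPoint i s k))
theorem2p5 d _ s s≢0 i 1≤i i≤d s-const s-incr = mk⇔ Fano⇒condition condition⇒Fano , interior
  where
  P : Subset d
  P = LectureHall s s≢0

  Condition : Set
  Condition = Tight s s≢0 i 1≤i i≤d s-const s-incr

  interior⇒ : ∀ {z} → Interior P (lattice z) →
    Σ[ v ∈ Vector ℕ d ] IsCochain s v × (∀ k → z k ≡ + s k ℤ.- + v k)
  interior⇒ {z} p = (λ k → ℤ.∣ + s k ℤ.- z k ∣) , IsChain⇒IsCochain z≡ (Interior⇒IsChain s s≢0 p) , z≡
    where z≡ = complement s s≢0 (Interior⇒IsChain s s≢0 p)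

  interior⇐ : ∀ {z v} → (∀ k → z k ≡ + s k ℤ.- + v k) → IsCochain s v → Interior P (lattice z)
  interior⇐ z≡s-v C = IsChain⇒Interior s s≢0 (IsCochain⇒IsChain z≡s-v C)

  i<s₁ : Condition → ∀ k → index k ≡ 1 → i ℕ.< s k
  i<s₁ (s≡1+i , _) k k≡1 = ℕ.≤-reflexive (sym (s≡1+i k (subst (ℕ._≤ i) (sym k≡1) 1≤i)))

  interior : Condition → ∀ z → Interior P (lattice z) ⇔ (∀ k → z k ≡ interiorPoint i s k)
  interior cond z = mk⇔
    (λ p k → let v , C , z≡s-v = interior⇒ {z} p in begin
      z k                       ≡⟨ z≡s-v k ⟩
      + s k ℤ.- + v k           ≡⟨ cong (λ n → + s k ℤ.- + n) (ℕ.≤-antisym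
                                     (Tight⇒≤staircase s s≢0 i 1≤i i≤d s-const s-incr cond C k)
                                     (IsCochain⇒staircase≤ s s≢0 i 1≤i i≤d s-const s-incr C k)) ⟩
      + s k ℤ.- + staircase i k ≡⟨ interiorPoint≡ s i (proj₁ cond) k ⟨
      interiorPoint i s k       ∎)
    (λ z≡ → interior⇐ (λ k → trans (z≡ k) (interiorPoint≡ s i (proj₁ cond) k))
      (staircase-IsCochain s s≢0 i 1≤i i≤d s-const s-incr ℕ.≤-refl (i<s₁ cond)))
    where open ≡-Reasoning

  -- The origin of `Q` comes from the interior point `-t` of `P`, with complement `v`. Any solution
  -- `w` yields the interior lattice point `s - w + t` of `Q`, which must be 0, so `w = v`.
  Fano⇒condition : ∃[ Q ] (IsFano Q × TranslationEquivalent P Q) → Condition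
  Fano⇒condition (Q , fano , t , Q≐P+t) =
    let v , C , -t≡s-v = interior⇒ (Interior-untranslate P-ext t Q≐P+t (λ _ → 0ℤ) (λ k → ℤ.- t k)
                           (λ k → sym (ℤ.+-inverseˡ (t k)))
                           (Equivalence.from (interiorLatticePoints (λ _ → 0ℤ)) λ _ → refl))
    in unique⇒Tight s s≢0 i 1≤i i≤d s-const s-incr C λ {w} Cw k → ℤ.+-injective (begin
      + w k
        ≡⟨ rearrange (+ s k) (+ w k) (t k) ⟩
      + s k ℤ.- (+ s k ℤ.- + w k ℤ.+ t k ℤ.- t k)
        ≡⟨ cong (λ x → + s k ℤ.- (x ℤ.- t k))
             (Equivalence.to (interiorLatticePoints (λ k → + s k ℤ.- + w k ℤ.+ t k))
               (Interior-translate P-ext t Q≐P+t _ (λ k → + s k ℤ.- + w k) (λ _ → refl)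
                 (interior⇐ (λ _ → refl) Cw)) k) ⟩
      + s k ℤ.- (0ℤ ℤ.- t k)
        ≡⟨ cong (λ x → + s k ℤ.- x) (trans (ℤ.+-identityˡ (ℤ.- t k)) (-t≡s-v k)) ⟩
      + s k ℤ.- (+ s k ℤ.- + v k)
        ≡⟨ ℤ-solve 2 (λ s v → s ⊖ (s ⊖ v) ⊜ v) refl (+ s k) (+ v k) ⟩
      + v k
        ∎)
    where
    open ≡-Reasoning
    open IsFano fano
    P-ext = λ {x} {y} → LectureHall-extensional s s≢0 {x} {y}

    rearrange : ∀ s w t → w ≡ s ℤ.- (s ℤ.- w ℤ.+ t ℤ.- t)
    rearrange = ℤ-solve 3 (λ s w t → w ⊜ s ⊖ (s ⊖ w ⊕ t ⊖ t)) refl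

  condition⇒Fano : Condition → ∃[ Q ] (IsFano Q × TranslationEquivalent P Q)
  condition⇒Fano cond = Q , fano , t , id-≐
    where
    t : Vector ℤ d
    -- Moves the unique interior lattice point to the origin.
    t k = ℤ.- interiorPoint i s k

    Q : Subset d
    Q = translate t P

    id-≐ : Q ≐ translate t P
    id-≐ = (λ q → q) , (λ q → q)

    P-ext = λ {x} {y} → LectureHall-extensional s s≢0 {x} {y}

    fano : IsFano Q
    fano = record
      { isLatticePolytope     = translate-isLatticePolytope s s≢0 t
      ; interiorLatticePoints = λ z → mk⇔
          (λ q k → begin
            z k
              ≡⟨ z≡ z k ⟩
            z k ℤ.- t k ℤ.+ t k
              ≡⟨ cong (ℤ._+ t k) (Equivalence.to (interior cond (λ k → z k ℤ.- t k))
                   (Interior-untranslate P-ext t id-≐ z (λ k → z k ℤ.- t k) (z≡ z) q) k) ⟩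
            interiorPoint i s k ℤ.+ t k
              ≡⟨ ℤ.+-inverseʳ (interiorPoint i s k) ⟩
            0ℤ
              ∎)
          (λ z≡0 → Interior-translate P-ext t id-≐ z (interiorPoint i s)
            (λ k → trans (z≡0 k) (sym (ℤ.+-inverseʳ (interiorPoint i s k))))
            (Equivalence.from (interior cond (interiorPoint i s)) λ _ → refl))
      }
      where
      open ≡-Reasoning
      z≡ : ∀ z k → z k ≡ z k ℤ.- t k ℤ.+ t k
      z≡ z k = ℤ-solve 2 (λ z t → z ⊜ z ⊖ t ⊕ t) refl (z k) (t k)
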